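{- Let $\Sigma$ be a finite alphabet of cardinality at least two. For every NP-hard set $A\subseteq\Sigma^*$ there exists a set $A'\subseteq\Sigma^*$ such that $A\le_m^p A'$ and $A'$ is in basic deterministic heuristic polynomial time.
   Context: $|x|$ is the length of a string $x$. $\le_m^p$ denotes polynomial-time many-one reducibility. The set $A$ need not be in NP and may even be undecidable. A distribution here is a family $\mu=\{\mu_n\}_{n\in\mathbb{N}}$, where each $\mu_n$ is a probability distribution over the strings of length $n$ (the weights sum to 1 at each length $n$). $\mathrm{Prob}_{\mu_n}[\cdot]$ is the probability when $x$ with $|x|=n$ is drawn according to $\mu_n$. Basic junta distribution: for an NP-hard problem $L$, a distribution $\mu=\{\mu_n\}_{n\in\mathbb{N}}$ over the possible instances of $L$ is a basic junta distribution if: (a) Hardness: the restriction of $L$ to $\mu$, i.e., the problem whose possible instances are only $\bigcup_{n\in\mathbb{N}}\{x\mid |x|=n\text{ and }\mu_n(x)>0\}$, is still NP-hard to decide. (b) Balance: there exist constants $c>1$ and $N\in\mathbb{N}$ such that for all $n\ge N$, with $x$ ranging over instances of length $n$, $1/c\le\mathrm{Prob}_{\mu_n}[x\in L]\le 1-1/c$. (c) Dichotomy: there exists a polynomial $p$ such that for all $n$ and all instances $x$ with $|x|=n$, either $\mu_n(x)\ge 2^{ -p(n)}$ or $\mu_n(x)=0$. Basic deterministic heuristic polynomial time: a set $L$ is in basic deterministic heuristic polynomial time if there exist a basic junta distribution $\mu$ for $L$, a deterministic polynomial-time algorithm $\mathcal{A}$, a polynomial $q$ of degree at least 1, and an $N\in\mathbb{N}$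 such that for each $n\ge N$, $\mathrm{Prob}_{\mu_n}[x\notin L\iff\mathcal{A}\text{ accepts }x]<\frac{1}{q(n)}$. -}

module Defs where

open import Algebra.Bundles.Raw using (RawSemiring)
open import Algebra.Definitions.RawMonoid using (sum)
open import Data.Bool.Base using (Bool; true; if_then_else_)
open import Data.Fin.Base using (Fin)
open import Data.Fin.Properties using (sequence)
open import Data.Integer.Base using (1ℤ; +_)
open import Data.List.Base using (List; []; _∷_; _++_; map; foldr; length; drop)
open import Data.List.Membership.Propositional using (_∈_)
open import Data.List.Relation.Unary.Any using (Any)
open import Data.Maybe.Base using (Maybe; just; nothing)
import Data.Nat.Base as ℕ
open import Data.Nat.Base using (ℕ)
open import Data.Nat.Properties using (m^n≢0)
open import Data.Product.Base using (Σ-syntax; ∃; ∃-syntax; _×_; _,_)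
open import Data.Rational.Base as ℚ
  using (ℚ; 0ℚ; 1ℚ; _≤_; _<_; _-_; 1/_; _/_; NonZero; >-nonZero)
import Data.Rational.Properties as ℚ
open import Data.Sum.Base using (_⊎_; inj₁)
open import Data.Vec.Base using (Vec; []; _∷_; fromList; toList)
open import Effect.Monad using (RawMonad)
open import Function.Base using (_∘_)
open import Function.Bundles using (_⇔_)
open import Level using (0ℓ)
open import Relation.Binary.PropositionalEquality.Core using (_≡_; _≢_)
open import Relation.Nullary.Decidable.Core using (Dec; does; ¬¬-excluded-middle)
open import Relation.Nullary.Negation using (¬_; ¬¬-Monad; ¬¬-map)
open import Relation.Unary using (Pred; Decidable; U)

------------------------------------------------------------------------
-- Polynomials, as coefficient lists with the constant term first

module _ {c ℓ} (R : RawSemiring c ℓ) where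
  open RawSemiring R

  eval : List Carrier → Carrier → Carrier
  eval as x = foldr (λ a r → a + x * r) 0# as

-- Used for upper bounds (running times, exponents).  Restricting to natural
-- coefficients loses nothing, as every polynomial is dominated on ℕ by one
-- of these.
evalℕ : List ℕ → ℕ → ℕ
evalℕ = eval ℕ.+-*-rawSemiring

evalℚ : List ℚ → ℕ → ℚ
evalℚ as n = eval ℚ.+-*-rawSemiring as (+ n / 1)

DegreeAtLeast1 : Pred (List ℚ) 0ℓ
DegreeAtLeast1 as = Any (_≢ 0ℚ) (drop 1 as)

------------------------------------------------------------------------
-- Strings and languages over the alphabet Fin k

String : ℕ → Set
String k = List (Fin k)

Language : ℕ → Set₁
Language k = Pred (String k) 0ℓ

------------------------------------------------------------------------
-- Turing machines with one two-way infinite read/write tape, initially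
-- holding the input, and a write-only output tape.  A transition may append
-- a finite string to the output; since there are finitely many transitions,
-- the output per step is bounded by a constant.  Recognizers ignore the
-- output, and transducers ignore the accepting states.

data Move : Set where
  left stay right : Move

-- Tape symbols: the blank (nothing), the input alphabet, and g extra symbols.
Symbol : ℕ → ℕ → Set
Symbol k g = Maybe (Fin k ⊎ Fin g)

record Action (k g s : ℕ) : Set where
  constructor action
  field
    next  : Fin s
    write : Symbol k g
    move  : Move
    emit  : String k

record Machine (k : ℕ) : Set where
  field
    extraSymbols : ℕ
    states       : ℕ
    start        : Fin states
    accepting    : Fin states → Bool
    -- The finite set of transitions available; the machine halts when it
    -- is empty.
    δ            : Fin states → Symbol k extraSymbols →
                   List (Action k extraSymbols states)

Deterministic : ∀ {k} → Machine k → Set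
Deterministic M = ∀ q a → length (δ q a) ℕ.≤ 1
  where open Machine M

module _ {Γ : Set} where

  scan : List (Maybe Γ) → Maybe Γ
  scan []      = nothing
  scan (a ∷ _) = a

  -- A tape is (ls , rs): rs begins with the scanned cell and continues to
  -- the right, ls begins with the cell left of it and continues to the left.
  -- Cells beyond the ends of the lists are blank.
  Tape : Set
  Tape = List (Maybe Γ) × List (Maybe Γ)

  update : Maybe Γ → Move → Tape → Tape
  update a left  (ls , rs) = drop 1 ls , scan ls ∷ a ∷ drop 1 rs
  update a stay  (ls , rs) = ls , a ∷ drop 1 rs
  update a right (ls , rs) = a ∷ ls , drop 1 rs

module _ {k : ℕ} (M : Machine k) where
  open Machine M

  record Config : Set where
    constructor config
    field
      state  : Fin states
      before : List (Symbol k extraSymbols)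
      after  : List (Symbol k extraSymbols)
      output : String k

  open Config

  initial : String k → Config
  initial x = config start [] (map (just ∘ inj₁) x) []

  transitions : Config → List (Action k extraSymbols states)
  transitions c = δ (state c) (scan (after c))

  perform : Action k extraSymbols states → Config → Config
  perform (action q a m w) (config _ ls rs o) =
    let (ls′ , rs′) = update a m (ls , rs) in config q ls′ rs′ (o ++ w)

  -- Path t c d: some computation leads from c to d in exactly t steps.
  data Path : ℕ → Config → Config → Set where
    done : ∀ {c} → Path 0 c c
    step : ∀ {t c d a} → a ∈ transitions c → Path t (perform a c) d →
           Path (ℕ.suc t) c d

  Halted : Pred Config 0ℓ
  Halted c = transitions c ≡ []

  Accepts : Language k
  Accepts x = ∃[ t ] ∃[ d ] Path t (initial x) d × Halted d ×
                            accepting (state d) ≡ true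

  -- For every input, all computation paths obey the bound.
  PolynomialTime : Set
  PolynomialTime = ∃[ p ] ∀ x {t d} → Path t (initial x) d →
                          t ℕ.≤ evalℕ p (length x)

  Computes : (String k → String k) → Set
  Computes f = ∀ x → ∃[ t ] ∃[ d ] Path t (initial x) d × Halted d ×
                                   output d ≡ f x

------------------------------------------------------------------------
-- NP, reducibility, hardness

module _ {k : ℕ} where

  PolyTimeComputable : (String k → String k) → Set
  PolyTimeComputable f =
    Σ[ M ∈ Machine k ] Deterministic M × PolynomialTime M × Computes M f

  NP : Pred (Language k) 0ℓ
  NP B = Σ[ M ∈ Machine k ] PolynomialTime M × (∀ x → B x ⇔ Accepts M x)

  -- Many-one reductions to the restriction of L to the instances in I.
  Reducible : Language k → (I L : Language k) → Set
  Reducible B I L =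
    ∃[ f ] PolyTimeComputable f × (∀ x → I (f x)) × (∀ x → B x ⇔ L (f x))

  infix 4 _≤ₘᵖ_
  _≤ₘᵖ_ : Language k → Language k → Set
  A ≤ₘᵖ B = Reducible A U B

  NPHardOn : (I L : Language k) → Set₁
  NPHardOn I L = ∀ B → NP B → Reducible B I L

  NPHard : Language k → Set₁
  NPHard = NPHardOn U

------------------------------------------------------------------------
-- Distributions.  Weights are rational.

Σ[strings] : ∀ {k} n → (Vec (Fin k) n → ℚ) → ℚ
Σ[strings] ℕ.zero    f = f []
Σ[strings] (ℕ.suc n) f =
  sum ℚ.+-0-rawMonoid (λ i → Σ[strings] n (λ x → f (i ∷ x)))

record Distribution (k : ℕ) : Set where
  field
    weight      : ∀ n → Vec (Fin k) n → ℚ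
    nonNegative : ∀ n x → 0ℚ ≤ weight n x
    total       : ∀ n → Σ[strings] n (weight n) ≡ 1ℚ

module _ {k : ℕ} (μ : Distribution k) where
  open Distribution μ

  Support : Language k
  Support x = 0ℚ < weight (length x) (fromList x)

  Prob : ∀ n {E : Language k} → Decidable {A = Vec (Fin k) n} (E ∘ toList) → ℚ
  Prob n E? = Σ[strings] n (λ x → if does (E? x) then weight n x else 0ℚ)

  -- "Prob_{μ_n}[E] satisfies R".  The event E may be undecidable, whereas
  -- its probability is a sum over the strings of length n that belong to E.
  -- Classically E? exists and the sum does not depend on it.
  -- Constructively E? cannot be refuted (see ¬¬-decidable), so the
  -- quantification is not vacuous; it is used below with the ¬¬-stable
  -- relations ≤ and < only.
  ProbSatisfies : ℕ → Language k → Pred ℚ 0ℓ → Set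
  ProbSatisfies n E R = (E? : Decidable (E ∘ toList)) → R (Prob n {E} E?)

¬¬-decidable : ∀ {k} n (E : Pred (Vec (Fin k) n) 0ℓ) → ¬ ¬ Decidable E
¬¬-decidable ℕ.zero    E = ¬¬-map (λ { d [] → d }) ¬¬-excluded-middle
¬¬-decidable (ℕ.suc n) E =
  ¬¬-map (λ { d (i ∷ x) → d i x })
    (sequence (RawMonad.rawApplicative ¬¬-Monad)
      (λ i → ¬¬-decidable n (λ x → E (i ∷ x))))

------------------------------------------------------------------------
-- Basic junta distributions

module _ {k : ℕ} (L : Language k) (μ : Distribution k) where
  open Distribution μ

  Hardness : Set₁
  Hardness = NPHardOn (Support μ) L

  record Balance : Set where
    field
      c   : ℚ
      1<c : 1ℚ < c

    c≢0 : NonZero c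
    c≢0 = >-nonZero (ℚ.<-trans (ℚ.positive⁻¹ 1ℚ) 1<c)

    1/c : ℚ
    1/c = (1/ c) {{c≢0}}

    field
      N        : ℕ
      balanced : ∀ n → N ℕ.≤ n →
                 ProbSatisfies μ n L (λ P → 1/c ≤ P × P ≤ 1ℚ - 1/c)

  2^-_ : ℕ → ℚ
  2^- m = (1ℤ / (2 ℕ.^ m)) {{m^n≢0 2 m}}

  Dichotomy : Set
  Dichotomy = ∃[ p ] ∀ n x → 2^- (evalℕ p n) ≤ weight n x ⊎ weight n x ≡ 0ℚ

  record IsBasicJunta : Set₁ where
    field
      nphard    : NPHard L
      hardness  : Hardness
      balance   : Balance
      dichotomy : Dichotomy

------------------------------------------------------------------------
-- Basic deterministic heuristic polynomial time

record BasicDetHeuristicPolyTime {k : ℕ} (L : Language k) : Set₁ where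
  field
    μ             : Distribution k
    junta         : IsBasicJunta L μ
    𝒜             : Machine k
    deterministic : Deterministic 𝒜
    polyTime      : PolynomialTime 𝒜
    q             : List ℚ
    degree        : DegreeAtLeast1 q
    N             : ℕ
    -- 1/q(n) has to be defined for n ≥ N.
    q≢0           : ∀ n → N ℕ.≤ n → NonZero (evalℚ q n)
    errorBound    : ∀ n (N≤n : N ℕ.≤ n) →
                    ProbSatisfies μ n (λ x → (¬ L x) ⇔ Accepts 𝒜 x)
                      (_< (1/ evalℚ q n) {{q≢0 n N≤n}})

{-# OPTIONS --safe #-}

-- A′ consists of the strings 00x with x ∈ A and of all strings 0jx with
-- j ≠ 0.  The map x ↦ 00x reduces A, hence every NP set, to A′.  At length
-- n ≥ 2, the distribution puts total weight 2⁻ⁿ on the prefix 00, weight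
-- 1/2 − 2⁻ⁿ on 01 and weight 1/2 on 10.  So the copy of A carries weight
-- too small to affect the balance, and "the first symbol is 0" decides A′ with
-- error probability at most 2⁻ⁿ < 1/n.
module Submission where

open import Defs
open import Algebra.Bundles using (CommutativeRing)
open import Data.Bool.Base using (true; false; if_then_else_)
open import Data.Empty using (⊥; ⊥-elim)
open import Data.Fin.Base using (Fin; zero; suc)
import Data.Integer.Base as ℤ
open import Data.Integer.Base using (1ℤ; +_)
import Data.Integer.Properties as ℤ
open import Data.List.Base using (List; []; _∷_; _++_; map; length)
open import Data.List.Membership.Propositional using (_∈_)
open import Data.List.Membership.Propositional.Properties using (∈-map⁺; ∈-map⁻)
open import Data.List.Properties using (++-assoc; ++-identityʳ; length-map)
open import Data.List.Relation.Unary.Any using (here)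
open import Data.Maybe.Base using (just; nothing)
open import Data.Nat.Base using (ℕ; zero; suc; _≤_; z≤n; s≤s)
import Data.Nat.Base as ℕ
import Data.Nat.Coprimality as Coprimality
import Data.Nat.Properties as ℕ
open import Data.Product.Base using (∃-syntax; _×_; _,_)
open import Data.Rational.Base as ℚ
  using (ℚ; 0ℚ; 1ℚ; ½; NonNegative; Positive; nonNegative; positive)
import Data.Rational.Properties as ℚ
open import Data.Rational.Solver using (module +-*-Solver)
import Data.Rational.Unnormalised.Base as ℚᵘ
import Data.Rational.Unnormalised.Properties as ℚᵘ
open import Data.Sum.Base using (_⊎_; inj₁; inj₂; map₁)
open import Data.Unit.Base using (⊤; tt)
open import Data.Vec.Base using (Vec; []; _∷_; fromList; toList)
open import Function.Base using (id; _∘_)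
open import Function.Bundles using (_⇔_; Equivalence)
import Function.Properties.Equivalence as ⇔
open import Relation.Binary.PropositionalEquality
  using (_≡_; refl; sym; trans; cong; cong₂; subst; module ≡-Reasoning)
open import Relation.Nullary.Decidable.Core using (does; yes; no)
open import Relation.Nullary.Negation using (¬_)
open import Relation.Unary using (Pred; Decidable)
open import Level using (0ℓ)

open import Algebra.Properties.Monoid.Sum ℚ.+-0-monoid
  using (sum; sum-cong-≗; sum-replicate-zero)
open import Algebra.Properties.Semiring.Sum (CommutativeRing.semiring ℚ.+-*-commutativeRing)
  using (*-distribˡ-sum)

evalℕ-linear : ∀ a n → evalℕ (0 ∷ a ∷ []) n ≡ n ℕ.* a
evalℕ-linear a n =
  cong (n ℕ.*_) (trans (cong (a ℕ.+_) (ℕ.*-zeroʳ n)) (ℕ.+-identityʳ a))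

-- Machines

module _ {k : ℕ} (M : Machine k) where

  halted⇒0-steps : ∀ {t c d} → Halted M c → Path M t c d → t ≡ 0
  halted⇒0-steps h done = refl
  halted⇒0-steps h (step α∈ _) with () ← subst (_ ∈_) h α∈

-- Transducers that write a fixed prefix ahead of their output

module Prefixed {k : ℕ} (w : String k) (M : Machine k) where
  open Machine M

  relabel : Action k extraSymbols states → Action k extraSymbols (suc states)
  relabel (action q a m e) = action (suc q) a m e

  relabelFirst : Action k extraSymbols states → Action k extraSymbols (suc states)
  relabelFirst (action q a m e) = action (suc q) a m (w ++ e)

  -- The prefix is emitted together with M's first action rather than in a
  -- separate step: rewriting the scanned cell of an empty tape would yield the
  -- list [ blank ] instead of [].
  first : Symbol k extraSymbols → List (Action k extraSymbols states) →
          List (Action k extraSymbols (suc states))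
  first a []         = action (suc start) a stay w ∷ []
  first a αs@(_ ∷ _) = map relabelFirst αs

  prefixed : Machine k
  prefixed = record
    { extraSymbols = extraSymbols
    ; states       = suc states
    ; start        = zero
    ; accepting    = λ _ → false
    ; δ            = λ { zero a → first a (δ start a) ; (suc q) a → map relabel (δ q a) }
    }

  prefixed-deterministic : Deterministic M → Deterministic prefixed
  prefixed-deterministic det zero a with δ start a | det start a
  ... | []         | _ = ℕ.≤-refl
  ... | αs@(_ ∷ _) | l = subst (_≤ 1) (sym (length-map relabelFirst αs)) l
  prefixed-deterministic det (suc q) a =
    subst (_≤ 1) (sym (length-map relabel (δ q a))) (det q a)

  first⁺ : ∀ {a α αs} → α ∈ αs → relabelFirst α ∈ first a αs
  first⁺ {αs = _ ∷ _} α∈ = ∈-map⁺ relabelFirst α∈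

  first⁻ : ∀ {a β} αs → β ∈ first a αs →
           (αs ≡ [] × β ≡ action (suc start) a stay w) ⊎
           (∃[ α ] α ∈ αs × β ≡ relabelFirst α)
  first⁻ []      (here refl) = inj₁ (refl , refl)
  first⁻ (_ ∷ _) β∈          = inj₂ (∈-map⁻ relabelFirst β∈)

  halt∈first : ∀ {a αs} → αs ≡ [] → action (suc start) a stay w ∈ first a αs
  halt∈first refl = here refl

  -- `w` is already on the output tape, so this describes the phase after the first step, in which
  -- `prefixed` simulates `M` step for step.
  embed : Config M → Config prefixed
  embed (config q ls rs o) = config (suc q) ls rs (w ++ o)

  perform-relabel : ∀ α c →
    perform prefixed (relabel α) (embed c) ≡ embed (perform M α c)
  perform-relabel (action q a m e) (config _ ls rs o) =
    cong (config _ _ _) (++-assoc w o e)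

  embed-path : ∀ {t c d} → Path M t c d → Path prefixed t (embed c) (embed d)
  embed-path done = done
  embed-path {suc t} {c} {d} (step {a = α} α∈ π) =
    step (∈-map⁺ relabel α∈)
      (subst (λ c′ → Path prefixed t c′ (embed d)) (sym (perform-relabel α c)) (embed-path π))

  -- In a state `suc q` the only actions are relabelled actions of `M`, so each step pulls back.
  -- `PolynomialTime` bounds all paths, hence the time bound needs this direction.
  unembed-path : ∀ {t d} c → Path prefixed t (embed c) d → ∃[ d′ ] Path M t c d′
  unembed-path c done = c , done
  unembed-path {suc t} {d} c (step β∈ π) with α , α∈ , refl ← ∈-map⁻ relabel β∈ =
    let d′ , π′ = unembed-path (perform M α c)
                    (subst (λ c′ → Path prefixed t c′ d) (perform-relabel α c) π)
    in d′ , step α∈ π′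

  embed-halted : ∀ c → Halted M c → Halted prefixed (embed c)
  embed-halted c h = cong (map relabel) h

  suc-poly : List ℕ → List ℕ
  suc-poly []       = 1 ∷ []
  suc-poly (a ∷ as) = suc a ∷ as

  evalℕ-suc-poly : ∀ p n → suc (evalℕ p n) ≤ evalℕ (suc-poly p) n
  evalℕ-suc-poly []      n = s≤s z≤n
  evalℕ-suc-poly (_ ∷ _) n = ℕ.≤-refl

  -- An extra step arises only where `M` halts at once; otherwise the first step of `prefixed` takes
  -- the place of that of `M`, and the lengths agree.
  prefixed-time : ∀ {b} x → (∀ {t d} → Path M t (initial M x) d → t ≤ b) →
                  ∀ {t d} → Path prefixed t (initial prefixed x) d → t ≤ suc b
  prefixed-time x bound done = z≤n
  prefixed-time x bound (step β∈ π) with first⁻ (transitions M (initial M x)) β∈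
  ... | inj₁ (h , refl)
        rewrite halted⇒0-steps prefixed (cong (map relabel) h) π = s≤s z≤n
  ... | inj₂ (α , α∈ , refl) =
        let _ , π′ = unembed-path (perform M α (initial M x)) π
        in ℕ.m≤n⇒m≤1+n (bound (step α∈ π′))

  prefixed-polyTime : PolynomialTime M → PolynomialTime prefixed
  prefixed-polyTime (p , bound) =
    suc-poly p , λ x π → ℕ.≤-trans (prefixed-time x (bound x) π) (evalℕ-suc-poly p (length x))

  prefixed-computes : ∀ {f} → Computes M f → Computes prefixed (λ x → w ++ f x)
  prefixed-computes comp x with comp x
  -- The step that emits `w` rewrites the scanned symbol with itself. Even if this turns an empty
  -- tape into one blank cell, the scanned symbol is the same, so `h` still gives halting.
  ... | _ , _ , done , h , out =
        1 , _ , step (halt∈first h) done ,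
        cong (map relabel) h ,
        trans (sym (++-identityʳ w)) (cong (w ++_) out)
  ... | suc t , d , step α∈ π , h , out =
        suc t , embed d , step (first⁺ α∈) (embed-path π) ,
        embed-halted d h , cong (w ++_) out

-- Applied below with `f` an arbitrary reduction to `A`, for hardness, and with `f` the identity,
-- for `pad` itself.
++-polyTimeComputable : ∀ {k} (w : String k) {f} → PolyTimeComputable f →
                        PolyTimeComputable (λ x → w ++ f x)
++-polyTimeComputable w (M , det , time , comp) =
  prefixed , prefixed-deterministic det , prefixed-polyTime time , prefixed-computes comp
  where open Prefixed w M

-- The identity transducer

module _ {k : ℕ} where

  copier : Machine k
  copier = record
    { extraSymbols = 0
    ; states       = 1
    ; start        = zero
    ; accepting    = λ _ → false
    ; δ            = λ { _ (just (inj₁ i)) → action zero nothing right (i ∷ []) ∷ []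
                       ; _ _               → [] }
    }

  copier-deterministic : Deterministic copier
  copier-deterministic q (just (inj₁ i)) = ℕ.≤-refl
  copier-deterministic q nothing         = z≤n

  copier-time : ∀ x {ls o t d} →
    Path copier t (config zero ls (map (just ∘ inj₁) x) o) d → t ≤ length x
  copier-time x       done                 = z≤n
  copier-time (i ∷ x) (step (here refl) π) = s≤s (copier-time x π)

  copier-run : ∀ x ls o →
    ∃[ d ] Path copier (length x) (config zero ls (map (just ∘ inj₁) x) o) d ×
           Halted copier d × Config.output d ≡ o ++ x
  copier-run []      ls o = _ , done , refl , sym (++-identityʳ o)
  copier-run (i ∷ x) ls o =
    let d , π , h , out = copier-run x (nothing ∷ ls) (o ++ i ∷ [])
    in d , step (here refl) π , h , trans out (++-assoc o (i ∷ []) x)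

  id-polyTimeComputable : PolyTimeComputable {k} id
  id-polyTimeComputable =
    copier , copier-deterministic ,
    ((0 ∷ 1 ∷ []) , λ x π → subst (_ ≤_)
      (sym (trans (evalℕ-linear 1 (length x)) (ℕ.*-identityʳ (length x)))) (copier-time x π)) ,
    λ x → _ , copier-run x [] []

-- The heuristic algorithm: a constant-time test of the first symbol

module _ {k : ℕ} where

  headAcceptor : Machine (suc k)
  headAcceptor = record
    { extraSymbols = 0
    ; states       = 2
    ; start        = zero
    ; accepting    = λ { zero → false ; (suc _) → true }
    ; δ            = λ { zero (just (inj₁ zero)) → action (suc zero) nothing stay [] ∷ []
                       ; _ _ → [] }
    }

  headAcceptor-deterministic : Deterministic headAcceptor
  headAcceptor-deterministic zero    (just (inj₁ zero))    = ℕ.≤-refl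
  headAcceptor-deterministic zero    (just (inj₁ (suc _))) = z≤n
  headAcceptor-deterministic zero    nothing               = z≤n
  headAcceptor-deterministic (suc _) _                     = z≤n

  headAcceptor-polyTime : PolynomialTime headAcceptor
  headAcceptor-polyTime = (1 ∷ []) , time
    where
    time : ∀ x {t d} → Path headAcceptor t (initial headAcceptor x) d →
           t ≤ evalℕ (1 ∷ []) (length x)
    time x          done                    = z≤n
    time (zero ∷ x) (step (here refl) done) = s≤s z≤n

  headAcceptor-accepts : ∀ x → Accepts headAcceptor (zero ∷ x)
  headAcceptor-accepts x = 1 , _ , step (here refl) done , refl , refl

  headAcceptor-rejects : ∀ i x → ¬ Accepts headAcceptor (suc i ∷ x)
  headAcceptor-rejects i x (_ , _ , done , _ , ())

-- Powers of one half

-- Recursive, so that inductions compute; `½^-≡-1/2^` links it to the fractions in `Dichotomy`.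
½^_ : ℕ → ℚ
½^ zero  = 1ℚ
½^ suc n = ½ ℚ.* ½^ n

½^-pos : ∀ n → Positive (½^ n)
½^-pos zero    = _
½^-pos (suc n) = ℚ.pos*pos⇒pos ½ (½^ n) {{½^-pos n}}

½^-nonNeg : ∀ n → NonNegative (½^ n)
½^-nonNeg n = ℚ.pos⇒nonNeg (½^ n) {{½^-pos n}}

½^-+ : ∀ m n → ½^ (m ℕ.+ n) ≡ ½^ m ℚ.* ½^ n
½^-+ zero    n = sym (ℚ.*-identityˡ (½^ n))
½^-+ (suc m) n = trans (cong (½ ℚ.*_) (½^-+ m n)) (sym (ℚ.*-assoc ½ (½^ m) (½^ n)))

½^-antitone : ∀ {m n} → m ≤ n → ½^ n ℚ.≤ ½^ m
½^-antitone {n = zero}  z≤n       = ℚ.≤-refl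
½^-antitone {n = suc n} z≤n       =
  ℚ.≤-trans (ℚ.*-monoˡ-≤-nonNeg ½ (½^-antitone (z≤n {n}))) (ℚ.≤ᵇ⇒≤ {½} {1ℚ} tt)
½^-antitone             (s≤s m≤n) = ℚ.*-monoˡ-≤-nonNeg ½ (½^-antitone m≤n)

-- Fractions in `ℚ` are stuck on a gcd for variable `d`. Between unnormalised rationals the equation
-- is a cross-multiplication that holds by `refl`.
1/[2*d] : ∀ d .{{_ : ℕ.NonZero d}} .{{_ : ℕ.NonZero (2 ℕ.* d)}} →
          1ℤ ℚ./ (2 ℕ.* d) ≡ ½ ℚ.* (1ℤ ℚ./ d)
1/[2*d] d@(suc d-1) = ℚ.toℚᵘ-injective (begin
  ℚ.toℚᵘ (1ℤ ℚ./ (2 ℕ.* d))             ≈⟨ ℚ.toℚᵘ-fromℚᵘ (1ℤ ℚᵘ./ (2 ℕ.* d)) ⟩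
  1ℤ ℚᵘ./ (2 ℕ.* d)                     ≈⟨ ℚᵘ.*≡* refl ⟩
  ℚᵘ.½ ℚᵘ.* (1ℤ ℚᵘ./ d)                 ≈⟨ ℚᵘ.*-congˡ {ℚᵘ.½} (ℚ.toℚᵘ-fromℚᵘ (1ℤ ℚᵘ./ d)) ⟨
  ℚ.toℚᵘ ½ ℚᵘ.* ℚ.toℚᵘ (1ℤ ℚ./ d)       ≈⟨ ℚ.toℚᵘ-homo-* ½ (1ℤ ℚ./ d) ⟨
  ℚ.toℚᵘ (½ ℚ.* (1ℤ ℚ./ d))             ∎)
  where open import Relation.Binary.Reasoning.Setoid ℚᵘ.≃-setoid

½^-≡-1/2^ : ∀ n .{{_ : ℕ.NonZero (2 ℕ.^ n)}} → 1ℤ ℚ./ (2 ℕ.^ n) ≡ ½^ n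
½^-≡-1/2^ zero    = refl
½^-≡-1/2^ (suc n) = trans (1/[2*d] (2 ℕ.^ n)) (cong (½ ℚ.*_) (½^-≡-1/2^ n))
  where instance _ = ℕ.m^n≢0 2 n

suc/1 : ∀ n → + suc n ℚ./ 1 ≡ 1ℚ ℚ.+ + n ℚ./ 1
suc/1 n = sym (trans (cong (1ℚ ℚ.+_) (ℚ.↥p/↧p≡p n/1))
  (cong (λ z → z ℚ./ 1) (cong (ℤ._+_ 1ℤ) (ℤ.*-identityʳ (+ n)))))
  -- With `+ n / 1` replaced by its explicit lowest terms, the addition of `1ℚ` computes.
  where n/1 = ℚ.mkℚ (+ n) 0 (Coprimality.sym (Coprimality.1-coprimeTo n))

-- By induction: the value at `suc n` is the mean of `½^ n`, which is at most 1, and the value at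
-- `n`, which is less than 1.
½^n*n<1 : ∀ n → ½^ n ℚ.* (+ n ℚ./ 1) ℚ.< 1ℚ
½^n*n<1 zero    = ℚ.positive⁻¹ 1ℚ
½^n*n<1 (suc n) = begin-strict
  ½^ suc n ℚ.* (+ suc n ℚ./ 1)
    ≡⟨ cong (½^ suc n ℚ.*_) (suc/1 n) ⟩
  ½^ suc n ℚ.* (1ℚ ℚ.+ + n ℚ./ 1)
    ≡⟨ solve 2 (λ h x → con ½ :* h :* (con 1ℚ :+ x) := con ½ :* (h :+ h :* x))
         refl (½^ n) (+ n ℚ./ 1) ⟩
  ½ ℚ.* (½^ n ℚ.+ ½^ n ℚ.* (+ n ℚ./ 1))
    <⟨ ℚ.*-monoʳ-<-pos ½ (ℚ.+-mono-≤-< (½^-antitone (z≤n {n})) (½^n*n<1 n)) ⟩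
  ½ ℚ.* (1ℚ ℚ.+ 1ℚ)
    ≡⟨⟩
  1ℚ
    ∎
  where
  open ℚ.≤-Reasoning
  open +-*-Solver

<1/ : ∀ x y .{{_ : ℚ.NonZero x}} → NonNegative x → y ℚ.* x ℚ.< 1ℚ → y ℚ.< ℚ.1/ x
<1/ x y x≥0 yx<1 = ℚ.*-cancelʳ-<-nonNeg x {{x≥0}} (subst (y ℚ.* x ℚ.<_) (sym (ℚ.*-inverseˡ x)) yx<1)

identity : List ℚ
identity = 0ℚ ∷ 1ℚ ∷ []

evalℚ-identity : ∀ n → evalℚ identity n ≡ + n ℚ./ 1
evalℚ-identity n =
  solve 1 (λ x → con 0ℚ :+ x :* (con 1ℚ :+ x :* con 0ℚ) := x) refl (+ n ℚ./ 1)
  where open +-*-Solver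

½^<1/evalℚ-identity : ∀ n .{{_ : ℚ.NonZero (evalℚ identity n)}} →
                      ½^ n ℚ.< ℚ.1/ evalℚ identity n
½^<1/evalℚ-identity n = <1/ (evalℚ identity n) (½^ n)
  (subst NonNegative (sym (evalℚ-identity n)) (ℚ.normalize-nonNeg n 1))
  (subst (λ x → ½^ n ℚ.* x ℚ.< 1ℚ) (sym (evalℚ-identity n)) (½^n*n<1 n))

-- Sums over strings

module _ {k : ℕ} where

  sum-mono : ∀ {n} {f g : Fin n → ℚ} → (∀ i → f i ℚ.≤ g i) → sum f ℚ.≤ sum g
  sum-mono {zero}  f≤g = ℚ.≤-refl
  sum-mono {suc n} f≤g = ℚ.+-mono-≤ (f≤g zero) (sum-mono (f≤g ∘ suc))

  Σ-mono : ∀ n {f g : Vec (Fin k) n → ℚ} → (∀ x → f x ℚ.≤ g x) →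
           Σ[strings] n f ℚ.≤ Σ[strings] n g
  Σ-mono zero    f≤g = f≤g []
  Σ-mono (suc n) f≤g = sum-mono λ i → Σ-mono n λ x → f≤g (i ∷ x)

  Σ-distribˡ : ∀ n c (f : Vec (Fin k) n → ℚ) →
               Σ[strings] n (λ x → c ℚ.* f x) ≡ c ℚ.* Σ[strings] n f
  Σ-distribˡ zero    c f = refl
  Σ-distribˡ (suc n) c f =
    trans (sum-cong-≗ λ i → Σ-distribˡ n c (λ x → f (i ∷ x)))
          (sym (*-distribˡ-sum c (λ i → Σ[strings] n (λ x → f (i ∷ x)))))

  module _ {n} {E : Pred (Vec (Fin k) n) 0ℓ} (E? : Decidable E) {f g : Vec (Fin k) n → ℚ} where

    Σ-event : ℚ
    Σ-event = Σ[strings] n (λ x → if does (E? x) then f x else 0ℚ)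

    -- This and its dual below bound a probability by a full sum without any event. `E?` is only
    -- split on, so the bounds hold for every decision of an event that depends on `A`.
    Σ-event-≤ : (∀ x → 0ℚ ℚ.≤ g x) → (∀ x → E x → f x ℚ.≤ g x) →
                Σ-event ℚ.≤ Σ[strings] n g
    Σ-event-≤ 0≤g f≤g = Σ-mono n pointwise
      where
      pointwise : ∀ x → (if does (E? x) then f x else 0ℚ) ℚ.≤ g x
      pointwise x with E? x
      ... | yes e = f≤g x e
      ... | no  _ = 0≤g x

    ≤-Σ-event : (∀ x → g x ℚ.≤ f x) → (∀ x → ¬ E x → g x ℚ.≤ 0ℚ) →
                Σ[strings] n g ℚ.≤ Σ-event
    ≤-Σ-event g≤f g≤0 = Σ-mono n pointwise
      where
      pointwise : ∀ x → g x ℚ.≤ (if does (E? x) then f x else 0ℚ)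
      pointwise x with E? x
      ... | yes _ = g≤f x
      ... | no ¬e = g≤0 x ¬e

-- A product distribution with full support and dyadic weights

-- The weights are 1/2, 1/4, ..., 2⁻ᵐ, 2⁻ᵐ. Being powers of one half, they give the lower bound for
-- the dichotomy directly, whatever the alphabet size.
symbolWeight : ∀ {m} → Fin (suc m) → ℚ
symbolWeight {zero}  _       = 1ℚ
symbolWeight {suc m} zero    = ½
symbolWeight {suc m} (suc i) = ½ ℚ.* symbolWeight i

stringWeight : ∀ {m n} → Vec (Fin (suc m)) n → ℚ
stringWeight []      = 1ℚ
stringWeight (i ∷ x) = symbolWeight i ℚ.* stringWeight x

sum-symbolWeight : ∀ m → sum (symbolWeight {m}) ≡ 1ℚ
sum-symbolWeight zero    = refl
sum-symbolWeight (suc m) = cong (½ ℚ.+_)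
  (trans (sym (*-distribˡ-sum ½ (symbolWeight {m}))) (cong (½ ℚ.*_) (sum-symbolWeight m)))

Σ-stringWeight : ∀ {m} n → Σ[strings] n (stringWeight {m}) ≡ 1ℚ
Σ-stringWeight     zero    = refl
Σ-stringWeight {m} (suc n) = begin
  sum (λ i → Σ[strings] n (λ x → w i ℚ.* stringWeight {m} x))
    ≡⟨ sum-cong-≗ (λ i → Σ-distribˡ n (w i) (stringWeight {m})) ⟩
  sum (λ i → w i ℚ.* Σ[strings] n (stringWeight {m}))
    ≡⟨ sum-cong-≗ (λ i → cong (w i ℚ.*_) (Σ-stringWeight {m} n)) ⟩
  sum (λ i → w i ℚ.* 1ℚ)
    ≡⟨ sum-cong-≗ (λ i → ℚ.*-identityʳ (w i)) ⟩
  sum w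
    ≡⟨ sum-symbolWeight m ⟩
  1ℚ
    ∎
  where
  open ≡-Reasoning
  w = symbolWeight {m}

½^≤symbolWeight : ∀ {m} (i : Fin (suc m)) → ½^ m ℚ.≤ symbolWeight i
½^≤symbolWeight {zero}  _       = ℚ.≤-refl
½^≤symbolWeight {suc m} zero    = ½^-antitone (s≤s (z≤n {m}))
½^≤symbolWeight {suc m} (suc i) = ℚ.*-monoˡ-≤-nonNeg ½ (½^≤symbolWeight i)

*-lower : ∀ a b {x y} → ½^ a ℚ.≤ x → ½^ b ℚ.≤ y → ½^ (a ℕ.+ b) ℚ.≤ x ℚ.* y
*-lower a b {x} {y} ½^a≤x ½^b≤y = begin
  ½^ (a ℕ.+ b)     ≡⟨ ½^-+ a b ⟩
  ½^ a ℚ.* ½^ b    ≤⟨ ℚ.*-monoʳ-≤-nonNeg (½^ b) {{½^-nonNeg b}} ½^a≤x ⟩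
  x ℚ.* ½^ b       ≤⟨ ℚ.*-monoˡ-≤-nonNeg x {{x≥0}} ½^b≤y ⟩
  x ℚ.* y          ∎
  where
  open ℚ.≤-Reasoning
  x≥0 : NonNegative x
  x≥0 = nonNegative (ℚ.≤-trans (ℚ.nonNegative⁻¹ (½^ a) {{½^-nonNeg a}}) ½^a≤x)

½^≤stringWeight : ∀ {m n} (x : Vec (Fin (suc m)) n) → ½^ (n ℕ.* m) ℚ.≤ stringWeight x
½^≤stringWeight         []      = ℚ.≤-refl
½^≤stringWeight {m} {suc n} (i ∷ x) =
  *-lower m (n ℕ.* m) (½^≤symbolWeight i) (½^≤stringWeight x)

-- Full support is what places every `pad x` in the support of `μ`.
stringWeight-pos : ∀ {m n} (x : Vec (Fin (suc m)) n) → 0ℚ ℚ.< stringWeight x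
stringWeight-pos {m} {n} x = ℚ.<-≤-trans (ℚ.positive⁻¹ _ {{½^-pos (n ℕ.* m)}}) (½^≤stringWeight x)

stringWeight-nonNeg : ∀ {m n} (x : Vec (Fin (suc m)) n) → NonNegative (stringWeight x)
stringWeight-nonNeg x = nonNegative (ℚ.<⇒≤ (stringWeight-pos x))

-- Distributions determined by the first two symbols

module _ {k : ℕ} where

  row : ℚ → ℚ → Fin (2 ℕ.+ k) → ℚ
  row a b zero          = a
  row a b (suc zero)    = b
  row a b (suc (suc _)) = 0ℚ

  -- The entries belong to the prefixes 00, 01 and 10. The weights of `μ` and all functions compared
  -- with them have this shape, so one formula sums them all.
  table : ℚ → ℚ → ℚ → Fin (2 ℕ.+ k) → Fin (2 ℕ.+ k) → ℚ
  table a b c zero          = row a b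
  table a b c (suc zero)    = row c 0ℚ
  table a b c (suc (suc _)) = row 0ℚ 0ℚ

  module _ (R : ℚ → ℚ → Set) (r₀ : R 0ℚ 0ℚ) where

    row-pointwise : ∀ {a b a′ b′} → R a a′ → R b b′ → ∀ j → R (row a b j) (row a′ b′ j)
    row-pointwise ra rb zero          = ra
    row-pointwise ra rb (suc zero)    = rb
    row-pointwise ra rb (suc (suc _)) = r₀

    -- Used for monotonicity, nonnegativity and dichotomy. The last two are unary properties, passed
    -- as relations constant in the first argument, with zeros filled in there.
    table-pointwise : ∀ {a b c a′ b′ c′} → R a a′ → R b b′ → R c c′ →
                      ∀ i j → R (table a b c i j) (table a′ b′ c′ i j)
    table-pointwise ra rb rc zero          = row-pointwise ra rb
    table-pointwise ra rb rc (suc zero)    = row-pointwise rc r₀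
    table-pointwise ra rb rc (suc (suc _)) = row-pointwise r₀ r₀

  prefixWeight : ∀ {n} → (Fin (2 ℕ.+ k) → Fin (2 ℕ.+ k) → ℚ) → Vec (Fin (2 ℕ.+ k)) (2 ℕ.+ n) → ℚ
  prefixWeight t (i ∷ j ∷ x) = t i j ℚ.* stringWeight x

  sum-row : ∀ a b → sum (row a b) ≡ a ℚ.+ b
  sum-row a b = cong (a ℚ.+_)
    (trans (cong (b ℚ.+_) (sum-replicate-zero k)) (ℚ.+-identityʳ b))

  sum-table : ∀ a b c → sum (λ i → sum (table a b c i)) ≡ a ℚ.+ b ℚ.+ c
  sum-table a b c = cong₂ ℚ._+_ (sum-row a b) (begin
    sum (row c 0ℚ) ℚ.+ sum {k} (λ _ → sum (row 0ℚ 0ℚ))  ≡⟨ cong₂ ℚ._+_ (sum-row c 0ℚ) (sum-cong-≗ {k} (λ _ → sum-row 0ℚ 0ℚ)) ⟩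
    (c ℚ.+ 0ℚ) ℚ.+ sum {k} (λ _ → 0ℚ)                   ≡⟨ cong₂ ℚ._+_ (ℚ.+-identityʳ c) (sum-replicate-zero k) ⟩
    c ℚ.+ 0ℚ                                            ≡⟨ ℚ.+-identityʳ c ⟩
    c                                                   ∎)
    where open ≡-Reasoning

  -- For each prefix the weights of the remaining symbols sum to 1, which leaves the sum of the
  -- table.
  Σ-prefixWeight : ∀ n a b c →
    Σ[strings] (2 ℕ.+ n) (prefixWeight (table a b c)) ≡ a ℚ.+ b ℚ.+ c
  Σ-prefixWeight n a b c = begin
    sum (λ i → sum (λ j → Σ[strings] n (λ x → t i j ℚ.* w x)))
      ≡⟨ sum-cong-≗ (λ i → sum-cong-≗ (λ j → Σ-distribˡ n (t i j) w)) ⟩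
    sum (λ i → sum (λ j → t i j ℚ.* Σ[strings] n w))
      ≡⟨ sum-cong-≗ (λ i → sum-cong-≗ (λ j → cong (t i j ℚ.*_) (Σ-stringWeight {suc k} n))) ⟩
    sum (λ i → sum (λ j → t i j ℚ.* 1ℚ))
      ≡⟨ sum-cong-≗ (λ i → sum-cong-≗ (λ j → ℚ.*-identityʳ (t i j))) ⟩
    sum (λ i → sum (t i))
      ≡⟨ sum-table a b c ⟩
    a ℚ.+ b ℚ.+ c
      ∎
    where
    open ≡-Reasoning
    t = table a b c
    w = stringWeight {suc k} {n}

  prefixWeight-mono : ∀ {n a b c a′ b′ c′} → a ℚ.≤ a′ → b ℚ.≤ b′ → c ℚ.≤ c′ →
    (x : Vec (Fin (2 ℕ.+ k)) (2 ℕ.+ n)) →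
    prefixWeight (table a b c) x ℚ.≤ prefixWeight (table a′ b′ c′) x
  prefixWeight-mono a≤ b≤ c≤ (i ∷ j ∷ x) =
    ℚ.*-monoʳ-≤-nonNeg (stringWeight x) {{stringWeight-nonNeg x}}
      (table-pointwise ℚ._≤_ ℚ.≤-refl a≤ b≤ c≤ i j)

  prefixWeight-≥0 : ∀ {n a b c} → 0ℚ ℚ.≤ a → 0ℚ ℚ.≤ b → 0ℚ ℚ.≤ c →
    (x : Vec (Fin (2 ℕ.+ k)) (2 ℕ.+ n)) → 0ℚ ℚ.≤ prefixWeight (table a b c) x
  prefixWeight-≥0 {a = a} {b} {c} 0≤a 0≤b 0≤c (i ∷ j ∷ x) =
    subst (ℚ._≤ t i j ℚ.* stringWeight x) (ℚ.*-zeroˡ (stringWeight x))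
      (ℚ.*-monoʳ-≤-nonNeg (stringWeight x) {{stringWeight-nonNeg x}}
        (table-pointwise (λ _ → 0ℚ ℚ.≤_) ℚ.≤-refl {0ℚ} {0ℚ} {0ℚ} 0≤a 0≤b 0≤c i j))
    where t = table a b c

  -- A prefix outside the three gives weight exactly 0; at the three, the lower bounds for the entry
  -- and for the `n` remaining symbols multiply.
  prefixWeight-dichotomy : ∀ {n a b c} d → ½^ d ℚ.≤ a → ½^ d ℚ.≤ b → ½^ d ℚ.≤ c →
    (x : Vec (Fin (2 ℕ.+ k)) (2 ℕ.+ n)) →
    ½^ (d ℕ.+ n ℕ.* suc k) ℚ.≤ prefixWeight (table a b c) x ⊎
    prefixWeight (table a b c) x ≡ 0ℚ
  prefixWeight-dichotomy {n} d d≤a d≤b d≤c (i ∷ j ∷ x) =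
    entry (table-pointwise (λ _ t → ½^ d ℚ.≤ t ⊎ t ≡ 0ℚ) (inj₂ refl) {0ℚ} {0ℚ} {0ℚ}
      (inj₁ d≤a) (inj₁ d≤b) (inj₁ d≤c) i j)
    where
    entry : ∀ {t} → ½^ d ℚ.≤ t ⊎ t ≡ 0ℚ →
            ½^ (d ℕ.+ n ℕ.* suc k) ℚ.≤ t ℚ.* stringWeight x ⊎ t ℚ.* stringWeight x ≡ 0ℚ
    entry (inj₁ d≤t)  = inj₁ (*-lower d (n ℕ.* suc k) d≤t (½^≤stringWeight x))
    entry (inj₂ refl) = inj₂ (ℚ.*-zeroˡ (stringWeight x))

-- The padded language

-- One quarter lies between the two sides. Hence the weight of 01 is nonnegative and has the same
-- lower bound as that of 00.
½^[2+n]≤½-½^[2+n] : ∀ n → ½^ (2 ℕ.+ n) ℚ.≤ ½ ℚ.- ½^ (2 ℕ.+ n)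
½^[2+n]≤½-½^[2+n] n = ℚ.≤-trans ≤¼ (ℚ.+-monoʳ-≤ ½ (ℚ.neg-antimono-≤ ≤¼))
  where
  ≤¼ : ½^ (2 ℕ.+ n) ℚ.≤ ½^ 2
  ≤¼ = ½^-antitone (s≤s (s≤s (z≤n {n})))

module Padding {k : ℕ} (A : Language (2 ℕ.+ k)) where

  Padded : Language (2 ℕ.+ k)
  Padded (zero ∷ zero ∷ x)  = A x
  Padded (zero ∷ suc _ ∷ x) = ⊤
  Padded _                  = ⊥

  pad : String (2 ℕ.+ k) → String (2 ℕ.+ k)
  pad x = (zero ∷ zero ∷ []) ++ x

  rest : ℕ → ℚ
  rest n = ½ ℚ.- ½^ n

  weights : ℕ → Fin (2 ℕ.+ k) → Fin (2 ℕ.+ k) → ℚ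
  weights n = table (½^ n) (rest n) ½

  ½^-≥0 : ∀ n → 0ℚ ℚ.≤ ½^ n
  ½^-≥0 n = ℚ.nonNegative⁻¹ (½^ n) {{½^-nonNeg n}}

  rest-≥0 : ∀ n → 0ℚ ℚ.≤ rest (2 ℕ.+ n)
  rest-≥0 n = ℚ.≤-trans (½^-≥0 (2 ℕ.+ n)) (½^[2+n]≤½-½^[2+n] n)

  ½-≥0 : 0ℚ ℚ.≤ ½
  ½-≥0 = ½^-≥0 1

  μ : Distribution (2 ℕ.+ k)
  μ = record { weight = weight ; nonNegative = weight-≥0 ; total = total }
    where
    weight : ∀ n → Vec (Fin (2 ℕ.+ k)) n → ℚ
    -- Lengths below 2 have no two-symbol prefix. Balance and the error bound start at `N = 2`, so
    -- here only the total and the dichotomy matter.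
    weight 0               = stringWeight
    weight 1               = stringWeight
    weight n@(suc (suc _)) = prefixWeight (weights n)

    weight-≥0 : ∀ n x → 0ℚ ℚ.≤ weight n x
    weight-≥0 0             x = ℚ.<⇒≤ (stringWeight-pos x)
    weight-≥0 1             x = ℚ.<⇒≤ (stringWeight-pos x)
    weight-≥0 (suc (suc n)) x = prefixWeight-≥0 (½^-≥0 (2 ℕ.+ n)) (rest-≥0 n) ½-≥0 x

    total : ∀ n → Σ[strings] n (weight n) ≡ 1ℚ
    total 0             = Σ-stringWeight {suc k} 0
    total 1             = Σ-stringWeight {suc k} 1
    total (suc (suc n)) = trans (Σ-prefixWeight n (½^ (2 ℕ.+ n)) (rest (2 ℕ.+ n)) ½)
      (solve 1 (λ p → p :+ (con ½ :- p) :+ con ½ := con 1ℚ) refl (½^ (2 ℕ.+ n)))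
      where open +-*-Solver

  open Distribution μ

  pad-support : ∀ x → Support μ (pad x)
  pad-support x = ℚ.positive⁻¹ (½^ n ℚ.* stringWeight (fromList x))
    {{ℚ.pos*pos⇒pos (½^ n) {{½^-pos n}} _ {{positive (stringWeight-pos (fromList x))}}}}
    where n = 2 ℕ.+ length x

  -- `Padded (pad y)` reduces to `A y`, so the equivalence for `f` serves unchanged for `pad ∘ f`.
  -- The parameter `I` covers both NP-hardness of `Padded` and hardness on the support.
  padded-hardOn : ∀ I → (∀ x → I (pad x)) → NPHard A → NPHardOn I Padded
  padded-hardOn I pad∈I hard B B∈NP =
    let f , f-poly , _ , B⇔A = hard B B∈NP
    in pad ∘ f , ++-polyTimeComputable _ f-poly , (λ x → pad∈I (f x)) , B⇔A

  balance : Balance Padded μ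
  balance = record
    -- For `n ≥ 2` the probability lies between 1/2 - 2⁻ⁿ ≥ 1/4 and 1/2, whatever `A` is; `1/c`
    -- evaluates to `½^ 2`.
    { c        = + 4 ℚ./ 1
    ; 1<c      = ℚ.*<* (ℤ.+<+ (s≤s (s≤s z≤n)))
    ; N        = 2
    ; balanced = λ { (suc (suc n)) (s≤s (s≤s _)) E? → lower n E? , upper n E? }
    }
    where
    lower : ∀ n → ProbSatisfies μ (2 ℕ.+ n) Padded (½^ 2 ℚ.≤_)
    lower n E? = begin
      ½^ 2
        ≤⟨ ℚ.+-monoʳ-≤ ½ (ℚ.neg-antimono-≤ (½^-antitone (s≤s (s≤s (z≤n {n}))))) ⟩
      q
        ≡⟨ solve 1 (λ q → q := con 0ℚ :+ q :+ con 0ℚ) refl q ⟩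
      0ℚ ℚ.+ q ℚ.+ 0ℚ
        ≡⟨ Σ-prefixWeight n 0ℚ q 0ℚ ⟨
      Σ[strings] (2 ℕ.+ n) g
        ≤⟨ ≤-Σ-event E? below outside ⟩
      Prob μ (2 ℕ.+ n) {Padded} E?
        ∎
      where
      open ℚ.≤-Reasoning
      open +-*-Solver
      q = rest (2 ℕ.+ n)
      -- Only 01 is counted: membership is certain there, whereas on 00 it depends on `A`.
      g = prefixWeight (table 0ℚ q 0ℚ)

      below : ∀ x → g x ℚ.≤ weight (2 ℕ.+ n) x
      below = prefixWeight-mono (½^-≥0 (2 ℕ.+ n)) ℚ.≤-refl ½-≥0

      0*≤0 : ∀ (x : Vec (Fin (2 ℕ.+ k)) n) → 0ℚ ℚ.* stringWeight x ℚ.≤ 0ℚ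
      0*≤0 x = ℚ.≤-reflexive (ℚ.*-zeroˡ (stringWeight x))

      outside : ∀ x → ¬ Padded (toList x) → g x ℚ.≤ 0ℚ
      outside (zero        ∷ zero        ∷ x) _ = 0*≤0 x
      outside (zero        ∷ suc _       ∷ x) ∉ = ⊥-elim (∉ tt)
      outside (suc zero    ∷ zero        ∷ x) _ = 0*≤0 x
      outside (suc zero    ∷ suc zero    ∷ x) _ = 0*≤0 x
      outside (suc zero    ∷ suc (suc _) ∷ x) _ = 0*≤0 x
      outside (suc (suc _) ∷ zero        ∷ x) _ = 0*≤0 x
      outside (suc (suc _) ∷ suc zero    ∷ x) _ = 0*≤0 x
      outside (suc (suc _) ∷ suc (suc _) ∷ x) _ = 0*≤0 x

    upper : ∀ n → ProbSatisfies μ (2 ℕ.+ n) Padded (ℚ._≤ 1ℚ ℚ.- ½^ 2)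
    upper n E? = begin
      Prob μ (2 ℕ.+ n) {Padded} E?
        ≤⟨ Σ-event-≤ E? (prefixWeight-≥0 (½^-≥0 (2 ℕ.+ n)) (rest-≥0 n) ℚ.≤-refl) inside ⟩
      Σ[strings] (2 ℕ.+ n) g
        ≡⟨ Σ-prefixWeight n p (½ ℚ.- p) 0ℚ ⟩
      p ℚ.+ (½ ℚ.- p) ℚ.+ 0ℚ
        ≡⟨ solve 1 (λ p → p :+ (con ½ :- p) :+ con 0ℚ := con ½) refl p ⟩
      ½
        ≤⟨ ℚ.≤ᵇ⇒≤ tt ⟩
      1ℚ ℚ.- ½^ 2
        ∎
      where
      open ℚ.≤-Reasoning
      open +-*-Solver
      p = ½^ (2 ℕ.+ n)
      -- The whole prefix 00 is counted as if it belonged to `Padded`; 10 contains no members.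
      g = prefixWeight (table p (½ ℚ.- p) 0ℚ)

      inside : ∀ x → Padded (toList x) → weight (2 ℕ.+ n) x ℚ.≤ g x
      inside (zero ∷ _ ∷ _) _ = ℚ.≤-refl

  dichotomy : Dichotomy Padded μ
  -- The exponent is `n * (2 + k)`: the prefix accounts for at most `n`, and each further symbol for
  -- at most `1 + k`.
  dichotomy = (0 ∷ 2 ℕ.+ k ∷ []) , λ n x →
    let instance _ = ℕ.m^n≢0 2 (evalℕ (0 ∷ 2 ℕ.+ k ∷ []) n) in
    subst (λ b → b ℚ.≤ weight n x ⊎ weight n x ≡ 0ℚ)
      (sym (trans (½^-≡-1/2^ (evalℕ (0 ∷ 2 ℕ.+ k ∷ []) n)) (cong ½^_ (evalℕ-linear (2 ℕ.+ k) n))))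
      (bound n x)
    where
    bound : ∀ n x → ½^ (n ℕ.* (2 ℕ.+ k)) ℚ.≤ weight n x ⊎ weight n x ≡ 0ℚ
    bound 0             x = inj₁ (½^≤stringWeight x)
    bound 1             x = inj₁ (ℚ.≤-trans
      (½^-antitone (ℕ.*-monoʳ-≤ 1 (ℕ.n≤1+n (suc k)))) (½^≤stringWeight x))
    bound (suc (suc n)) x = map₁ (ℚ.≤-trans (½^-antitone exponent))
      (prefixWeight-dichotomy (2 ℕ.+ n) ℚ.≤-refl (½^[2+n]≤½-½^[2+n] n)
        (½^-antitone (s≤s (z≤n {suc n}))) x)
      where
      exponent : 2 ℕ.+ n ℕ.+ n ℕ.* suc k ≤ (2 ℕ.+ n) ℕ.* (2 ℕ.+ k)
      exponent = subst (2 ℕ.+ n ℕ.+ n ℕ.* suc k ≤_) (sym (ℕ.*-suc (2 ℕ.+ n) (suc k)))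
        (ℕ.+-monoʳ-≤ (2 ℕ.+ n) (ℕ.*-monoˡ-≤ (suc k) (ℕ.m≤n+m n 2)))

  -- The event says that the answer is wrong. It is refuted on 01 and on every first symbol other
  -- than `zero`; all of 00 is counted as error.
  error : ∀ n → ProbSatisfies μ (2 ℕ.+ n) (λ x → (¬ Padded x) ⇔ Accepts headAcceptor x)
                  (ℚ._≤ ½^ (2 ℕ.+ n))
  error n E? = begin
    Prob μ (2 ℕ.+ n) {λ x → (¬ Padded x) ⇔ Accepts headAcceptor x} E?
      ≤⟨ Σ-event-≤ E? (prefixWeight-≥0 (½^-≥0 (2 ℕ.+ n)) ℚ.≤-refl ℚ.≤-refl) inside ⟩
    Σ[strings] (2 ℕ.+ n) g
      ≡⟨ Σ-prefixWeight n p 0ℚ 0ℚ ⟩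
    p ℚ.+ 0ℚ ℚ.+ 0ℚ
      ≡⟨ solve 1 (λ p → p :+ con 0ℚ :+ con 0ℚ := p) refl p ⟩
    p
      ∎
    where
    open ℚ.≤-Reasoning
    open +-*-Solver
    p = ½^ (2 ℕ.+ n)
    g = prefixWeight (table p 0ℚ 0ℚ)

    inside : ∀ x → (¬ Padded (toList x)) ⇔ Accepts headAcceptor (toList x) →
             weight (2 ℕ.+ n) x ℚ.≤ g x
    inside (zero ∷ zero ∷ x)  _ = ℚ.≤-refl
    inside (zero ∷ suc j ∷ x) e =
      ⊥-elim (Equivalence.from e (headAcceptor-accepts (toList (suc j ∷ x))) tt)
    -- Here `Padded` reduces to `⊥`, so `id` proves non-membership, and `e` would make the machine
    -- accept.
    inside (suc i ∷ x)        e =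
      ⊥-elim (headAcceptor-rejects i (toList x) (Equivalence.to e id))

  padded-heuristic : NPHard A → BasicDetHeuristicPolyTime Padded
  padded-heuristic hard = record
    { μ             = μ
    ; junta         = record
      { nphard    = padded-hardOn _ _ hard
      ; hardness  = padded-hardOn (Support μ) pad-support hard
      ; balance   = balance
      ; dichotomy = dichotomy
      }
    ; 𝒜             = headAcceptor
    ; deterministic = headAcceptor-deterministic
    ; polyTime      = headAcceptor-polyTime
    ; q             = identity
    ; degree        = here λ ()
    ; N             = 2
    ; q≢0           = identity≢0
    ; errorBound    = λ { n@(suc (suc n-2)) 2≤n@(s≤s (s≤s _)) E? →
        ℚ.≤-<-trans (error n-2 E?) (½^<1/evalℚ-identity n {{identity≢0 n 2≤n}}) }
    }
    where
    identity≢0 : ∀ n → 2 ≤ n → ℚ.NonZero (evalℚ identity n)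
    identity≢0 n@(suc _) _ = subst ℚ.NonZero (sym (evalℚ-identity n))
      (ℚ.pos⇒nonZero (+ n ℚ./ 1) {{ℚ.normalize-pos n 1}})

mainTheorem5 : (k : ℕ) → 2 ≤ k → (A : Language k) → NPHard A →
    ∃[ A′ ] (A ≤ₘᵖ A′) × BasicDetHeuristicPolyTime A′
mainTheorem5 (suc (suc k)) (s≤s (s≤s z≤n)) A hard =
  Padded ,
  (pad , ++-polyTimeComputable _ id-polyTimeComputable , _ , λ _ → ⇔.refl) ,
  padded-heuristic hard
  where open Padding A
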